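{- Let $U$ be a set of $n$ clauses and let $k$ be the maximum number of iterations (stages) performed by the algorithm PIC on $U$. Then the length of the formulas returned by PIC does not exceed $O(n^{k})$.
   Context: Setting: modal logic $\mathbf{K}$; the length of a formula is the number of occurrences of propositional variables, logical connectives and modal operators in it. Clauses are (possibly empty) disjunctions of literals, formulas $\Box D$ with $D$ a clause, and formulas $\Diamond A$ with $A$ a conjunction (set) of clauses. For a set of clauses $Y$, $\mathrm{Res}(Y)$ is a subset of $Y$ such that every clause of $Y$ is entailed by some clause of $\mathrm{Res}(Y)$ and no clause of $\mathrm{Res}(Y)$ entails another. Resolution: relations $\Sigma(A,B)\rightarrow C$ and $\Gamma(A)\rightarrow C$ defined by axioms $\Sigma(p,\neg p)\rightarrow\bot$, $\Sigma(\bot,A)\rightarrow\bot$; from $\Sigma(A,B)\rightarrow C$ infer $\Sigma(A\vee D_1,B\vee D_2)\rightarrow C\vee D_1\vee D_2$, $\Sigma(\Box A,\Diamond(B,E))\rightarrow\Diamond(B,C,E)$, $\Sigma(\Box A,\Box B)\rightarrow\Box C$, $\Gamma(\Diamond(A,B,F))\rightarrow\Diamond(A,B,C,F)$; from $\Gamma(A)\rightarrow B$ infer $\Gamma(\Diamond(A,F))\rightarrow\Diamond(B,A,F)$, $\Gamma(A\vee C)\rightarrow B\vee C$, $\Gamma(\Box A)\rightarrow\Box B$; a resolvent is the normal form of the result under the simplifications $\Diamond\bot\approx\bot$, $\bot\vee D\approx D$, $(\bot,E)\approx\bot$, $A\vee A\vee D\approx A\vee D$. $L(U')$ is $U'$ together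 with all resolvents of pairs $A,B\in U'$ (via $\Sigma$) and of single clauses $A\in U'$ (via $\Gamma$). Algorithm PIC: input a set of clauses $U$. If $U=\emptyset$, output $\emptyset$. Otherwise set $U_1=U$ and repeatedly compute $L(U_i)$ and set $U_{i+1}=\mathrm{Res}(L(U_i))$, until $U_i=U_{i+1}$; output $U_{i+1}$.
   Formalization: The constant hidden in O(n^k) may depend on a bound on the lengths of the input clauses (but not on U, n or k); with an absolute constant the claim fails, e.g. for one long clause p₁∨…∨p_m, where n = 1 and PIC returns it unchanged. -}

module Defs where

open import Data.Nat using (ℕ; zero; suc; _+_; _*_; _^_; _≤_)
open import Data.List using (List; []; _∷_; _++_; length; lookup)
open import Data.List.Relation.Unary.All using (All)
open import Data.List.Relation.Unary.Any using (Any)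
open import Data.List.Membership.Propositional using (_∈_)
open import Data.Fin using (Fin)
open import Data.Product using (Σ; _×_; _,_; ∃)
open import Data.Sum using (_⊎_)
open import Data.Empty using (⊥)
open import Data.Unit using (⊤)
open import Relation.Nullary using (¬_)
open import Relation.Binary.PropositionalEquality using (_≡_; _≢_)

-- Syntax of clauses of K.
-- A clause is a (possibly empty) disjunction of "atoms"; the empty
-- disjunction is ⊥.  An atom is a literal p / ¬p, a formula □D with D a
-- clause, or ◇A with A a conjunction (set) of clauses, represented as a list.

data Atom : Set where
  pos neg : ℕ → Atom
  box     : List Atom → Atom
  dia     : List (List Atom) → Atom

Clause : Set
Clause = List Atom

Conj : Set
Conj = List Clause

-- Length: occurrences of propositional variables, connectives (¬, ∨, ∧,
-- and the constants ⊥ / ⊤ for the empty disjunction / conjunction) and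
-- modal operators.

mutual
  lenA : Atom → ℕ
  lenA (pos p)  = 1
  lenA (neg p)  = 2
  lenA (box D)  = suc (lenC D)
  lenA (dia As) = suc (lenS As)

  lenC : Clause → ℕ
  lenC []           = 1
  lenC (a ∷ [])     = lenA a
  lenC (a ∷ b ∷ r)  = lenA a + suc (lenC (b ∷ r))

  lenS : Conj → ℕ
  lenS []           = 1
  lenS (c ∷ [])     = lenC c
  lenS (c ∷ d ∷ r)  = lenC c + suc (lenS (d ∷ r))

-- Identity of clauses as sets (disjunctions and conjunctions are sets):
-- equality modulo order and repetition, recursively.

mutual
  data _≈A_ : Atom → Atom → Set where
    pos≈ : ∀ {p} → pos p ≈A pos p
    neg≈ : ∀ {p} → neg p ≈A neg p
    box≈ : ∀ {C D} → C ≈C D → box C ≈A box D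
    dia≈ : ∀ {As Bs} → As ≈S Bs → dia As ≈A dia Bs

  data _≈C_ : Clause → Clause → Set where
    mkC : ∀ {xs ys} →
          All (λ a → Any (λ b → a ≈A b) ys) xs →
          All (λ b → Any (λ a → a ≈A b) xs) ys → xs ≈C ys

  data _≈S_ : Conj → Conj → Set where
    mkS : ∀ {xs ys} →
          All (λ a → Any (λ b → a ≈C b) ys) xs →
          All (λ b → Any (λ a → a ≈C b) xs) ys → xs ≈S ys

record Model : Set₁ where
  field
    W : Set
    R : W → W → Set
    V : ℕ → W → Set

module _ (M : Model) where
  open Model M
  mutual
    forceA : W → Atom → Set
    forceA w (pos p)  = V p w
    forceA w (neg p)  = ¬ V p w
    forceA w (box D)  = ∀ v → R w v → forceC v D
    forceA w (dia As) = Σ W λ v → R w v × forceS v As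

    forceC : W → Clause → Set
    forceC w []      = ⊥
    forceC w (a ∷ r) = forceA w a ⊎ forceC w r

    forceS : W → Conj → Set
    forceS w []      = ⊤
    forceS w (c ∷ r) = forceC w c × forceS w r

_⊨_ : Clause → Clause → Set₁
A ⊨ B = ∀ (M : Model) (w : Model.W M) → forceC M w A → forceC M w B

-- Resolution rules Σ(A,B) → C and Γ(A) → C (unsimplified results).
-- Inputs are taken up to set-identity of clauses (≈C); Σ is symmetric.

data Sig : Clause → Clause → Clause → Set where
  s-lit   : ∀ {p} → Sig (pos p ∷ []) (neg p ∷ []) []
  s-bot   : ∀ {A} → Sig [] A []
  s-sym   : ∀ {A B C} → Sig A B C → Sig B A C
  s-or    : ∀ {A B C D₁ D₂} → Sig A B C →
            Sig (A ++ D₁) (B ++ D₂) (C ++ D₁ ++ D₂)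
  s-boxdia : ∀ {A B C E} → Sig A B C →
            Sig (box A ∷ []) (dia (B ∷ E) ∷ []) (dia (B ∷ C ∷ E) ∷ [])
  s-boxbox : ∀ {A B C} → Sig A B C →
            Sig (box A ∷ []) (box B ∷ []) (box C ∷ [])
  s-cong  : ∀ {A A' B B' C} → A ≈C A' → B ≈C B' → Sig A B C → Sig A' B' C

data Gam : Clause → Clause → Set where
  g-dia2 : ∀ {A B C F} → Sig A B C →
           Gam (dia (A ∷ B ∷ F) ∷ []) (dia (A ∷ B ∷ C ∷ F) ∷ [])
  g-dia1 : ∀ {A B F} → Gam A B →
           Gam (dia (A ∷ F) ∷ []) (dia (B ∷ A ∷ F) ∷ [])
  g-or   : ∀ {A B C} → Gam A B → Gam (A ++ C) (B ++ C)
  g-box  : ∀ {A B} → Gam A B → Gam (box A ∷ []) (box B ∷ [])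
  g-cong : ∀ {A A' B} → A ≈C A' → Gam A B → Gam A' B

-- Simplification:  ◇⊥ ≈ ⊥,  ⊥ ∨ D ≈ D,  (⊥, E) ≈ ⊥,  A ∨ A ∨ D ≈ A ∨ D
-- (and, conjunctions being sets, repeated conjuncts are identified).
-- One simplification step anywhere inside a clause.

mutual
  data StepA : Atom → Atom → Set where
    in-box : ∀ {C D} → StepC C D → StepA (box C) (box D)
    in-dia : ∀ {As Bs} → StepS As Bs → StepA (dia As) (dia Bs)

  data StepC : Clause → Clause → Set where
    -- ◇(⊥, E) ∨ D  ~>  ◇⊥ ∨ D ~> ⊥ ∨ D ~> D
    drop-dia⊥ : ∀ {As D} → [] ∈ As → StepC (dia As ∷ D) D
    drop-dup  : ∀ {a D} → Any (λ b → a ≈A b) D → StepC (a ∷ D) D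
    here      : ∀ {a b D} → StepA a b → StepC (a ∷ D) (b ∷ D)
    there     : ∀ {a D D'} → StepC D D' → StepC (a ∷ D) (a ∷ D')

  data StepS : Conj → Conj → Set where
    drop-dup  : ∀ {c E} → Any (λ d → c ≈C d) E → StepS (c ∷ E) E
    here      : ∀ {c d E} → StepC c d → StepS (c ∷ E) (d ∷ E)
    there     : ∀ {c E E'} → StepS E E' → StepS (c ∷ E) (c ∷ E')

data Steps : Clause → Clause → Set where
  refl : ∀ {C} → Steps C C
  step : ∀ {C D E} → StepC C D → Steps D E → Steps C E

NF : Clause → Clause → Set
NF C N = Steps C N × (∀ N' → ¬ StepC N N')

data InL (U : List Clause) : Clause → Set where
  orig  : ∀ {X} → X ∈ U → InL U X
  resΣ  : ∀ {A B C N} → A ∈ U → B ∈ U → Sig A B C → NF C N → InL U N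
  resΓ  : ∀ {A C N} → A ∈ U → Gam A C → NF C N → InL U N

IsRes : (Clause → Set) → List Clause → Set₁
IsRes Y R =
  All Y R ×
  (∀ X → Y X → Any (λ Z → Z ⊨ X) R) ×
  (∀ (i j : Fin (length R)) → i ≢ j → ¬ (lookup R i ⊨ lookup R j))

_≋_ : List Clause → List Clause → Set
U ≋ V = U ≈S V

-- Run U k O : algorithm PIC on input U performs k iterations
-- (computations of U_{i+1} = Res(L(U_i))) and outputs O.
data Run : List Clause → ℕ → List Clause → Set₁ where
  r-empty : Run [] 0 []
  r-stop  : ∀ {U U'} → U ≢ [] → IsRes (InL U) U' → U ≋ U' → Run U 1 U'
  r-next  : ∀ {U U' k O} → U ≢ [] → IsRes (InL U) U' → ¬ (U ≋ U') →
            Run U' k O → Run U (suc k) O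

NoDup : List Clause → Set
NoDup U = ∀ (i j : Fin (length U)) → i ≢ j → ¬ (lookup U i ≈C lookup U j)

{-# OPTIONS --safe #-}
module Submission where

-- Resolution and simplification introduce no variables and do not increase modal depth, which is at
-- most ℓ on the input. A resolvent is longer than its premises by a factor at most M = growth ℓ, so k
-- stages give clauses of length at most ℓ · M ^ k, which settles the case M ≤ n. If n ≤ M, the whole
-- run uses at most M · ℓ variables at depth at most ℓ; normal forms are hereditarily free of
-- repetitions, so their length is bounded by a constant depending on ℓ only.

open import Defs
open import Data.Nat using (ℕ; zero; suc; _+_; _*_; _^_; _⊔_; _≤_; z≤n; s≤s)
open import Data.Nat.Properties
open import Data.List using (List; []; _∷_; _++_; length; map)
open import Data.List.Properties using (length-++; length-map)
open import Data.List.Relation.Unary.All as All using (All; []; _∷_)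
import Data.List.Relation.Unary.All.Properties as AllP
open import Data.List.Relation.Unary.Any as Any using (Any; here; there; _─_)
import Data.List.Relation.Unary.Any.Properties as AnyP
open import Data.List.Relation.Unary.AllPairs using (AllPairs; []; _∷_)
open import Data.List.Relation.Binary.Sublist.Propositional using (_⊆_; []; _∷_; _∷ʳ_; minimum)
open import Data.List.Membership.Propositional using (_∈_; find; lose)
open import Data.List.Membership.Propositional.Properties using (∈-++⁺ˡ; ∈-++⁺ʳ; ∈-map⁺)
open import Data.Product using (∃; Σ; _×_; _,_; proj₁; proj₂)
open import Data.Sum using (inj₁; inj₂)
open import Data.Empty using (⊥-elim)
open import Data.Nat.Solver using (module +-*-Solver)
open import Function using (_∘_; id)
open import Relation.Nullary using (¬_; Dec; yes; no)
open import Relation.Binary.PropositionalEquality using (_≡_; refl; sym; trans; cong; cong₂; subst; module ≡-Reasoning)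

-- The constant may depend on `ℓ` but on neither `n` nor `k`, so `M ^ k` cannot be absorbed into it;
-- `n ^ k` pays for it only when `M ≤ n`. With a single input clause `n ^ k` is 1 for every `k`,
-- which forces a bound that does not grow with the number of stages. The obstacle in estimating a
-- resolvent is that the unsimplified conclusion of a derivation has no length bound at all:
-- premises are taken up to set-identity, so `s-or` can add the same disjunct any number of times.
-- The conclusion `C` is therefore never measured. Instead a short clause `X` with `C ⊑ X` is
-- exhibited, and a normal form of `C` is no longer than any such `X`. The same comparison, with `X`
-- listing representatives of all atoms of bounded depth over finitely many variables, bounds the
-- normal forms in the case of few clauses.

Covered : {A B : Set} → (A → B → Set) → List A → List B → Set
Covered R xs ys = All (λ x → Any (R x) ys) xs

-- The extra unit per entry stands for the connective next to it. It makes the sum additive under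
-- `++`, which the length with its one connective fewer is not.
tot : {A : Set} → (A → ℕ) → List A → ℕ
tot f []       = 0
tot f (x ∷ xs) = suc (f x) + tot f xs

module _ {A : Set} (f : A → ℕ) where

  tot-++ : ∀ xs {ys} → tot f (xs ++ ys) ≡ tot f xs + tot f ys
  tot-++ []            = refl
  tot-++ (x ∷ xs) {ys} = cong suc (trans (cong (f x +_) (tot-++ xs)) (sym (+-assoc (f x) (tot f xs) (tot f ys))))

  tot-∈ : ∀ {x xs} → x ∈ xs → suc (f x) ≤ tot f xs
  tot-∈ {xs = x ∷ xs} (here refl) = m≤m+n _ _
  tot-∈ {xs = x ∷ xs} (there i)   = ≤-trans (tot-∈ i) (m≤n+m _ (suc (f x)))

  tot-⊆ : ∀ {xs ys} → xs ⊆ ys → tot f xs ≤ tot f ys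
  tot-⊆ []         = z≤n
  tot-⊆ (y ∷ʳ s)   = ≤-trans (tot-⊆ s) (m≤n+m _ (suc (f y)))
  tot-⊆ (refl ∷ s) = +-monoʳ-≤ _ (tot-⊆ s)

  length≤tot : ∀ xs → length xs ≤ tot f xs
  length≤tot []       = z≤n
  length≤tot (x ∷ xs) = s≤s (≤-trans (length≤tot xs) (m≤n+m _ (f x)))

  tot≤length* : ∀ {b xs} → All (λ x → f x ≤ b) xs → tot f xs ≤ length xs * suc b
  tot≤length* []       = z≤n
  tot≤length* (p ∷ ps) = +-mono-≤ (s≤s p) (tot≤length* ps)

-- Each entry already contributes at least one unit, so the one symbol that `h` adds at most doubles
-- the sum.
tot-map : {A B : Set} (f : A → ℕ) (g : B → ℕ) (h : A → B) → (∀ x → g (h x) ≡ suc (f x)) →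
          ∀ xs → tot g (map h xs) ≤ tot f xs + tot f xs
tot-map f g h e []       = z≤n
tot-map f g h e (x ∷ xs) rewrite e x = begin
  suc (suc (f x) + tot g (map h xs))                ≤⟨ s≤s (+-monoʳ-≤ (suc (f x)) (tot-map f g h e xs)) ⟩
  suc (suc (f x) + (tot f xs + tot f xs))           ≤⟨ s≤s (+-monoʳ-≤ (suc (f x)) (+-monoʳ-≤ (tot f xs) (m≤n+m _ (f x)))) ⟩
  suc (suc (f x) + (tot f xs + (f x + tot f xs)))   ≡⟨ cong suc (sym (+-assoc (suc (f x)) (tot f xs) _)) ⟩
  suc (suc (f x) + tot f xs + (f x + tot f xs))     ≡⟨ sym (+-suc (suc (f x) + tot f xs) _) ⟩
  suc (f x) + tot f xs + suc (f x + tot f xs)       ∎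
  where open ≤-Reasoning

-- Coverings between lists

module _ {A B : Set} (R : A → B → Set) where

  private
    insert : ∀ {x zs ys} → zs ⊆ ys → Any (R x) ys →
             Σ (List B) λ zs' → zs' ⊆ ys × (∀ {P : B → Set} → Any P zs → Any P zs') × Any (R x) zs' ×
               (∀ {P : B → Set} → All P zs → (∀ {y} → R x y → P y) → All P zs')
    insert (y ∷ʳ s)   (here r)  = _ , refl ∷ s , there , here r , λ ps q → q r ∷ ps
    insert (refl ∷ s) (here r)  = _ , refl ∷ s , id , here r , λ ps q → ps
    insert (y ∷ʳ s)   (there i) = let zs' , s' , inc , j , cov = insert s i in zs' , y ∷ʳ s' , inc , j , cov
    insert {zs = z ∷ _} (refl ∷ s) (there i) = let zs' , s' , inc , j , cov = insert s i in
      z ∷ zs' , refl ∷ s' , (λ { (here p) → here p ; (there p) → there (inc p) }) , there j ,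
      λ { (p ∷ ps) q → p ∷ cov ps q }

  -- Keeping only those entries of `ys` that some entry of `xs` needs turns a one-sided covering
  -- into a two-sided one, hence into set-identity for the relations used later. The sublist
  -- inherits every size bound of `ys`.
  covered⇒sublist : ∀ {xs ys} → Covered R xs ys →
    Σ (List B) λ zs → zs ⊆ ys × Covered R xs zs × All (λ z → Any (λ x → R x z) xs) zs
  covered⇒sublist []       = [] , minimum _ , [] , []
  covered⇒sublist (i ∷ is) =
    let zs , s , to , from = covered⇒sublist is
        zs' , s' , inc , j , cov = insert s i
    in zs' , s' , j ∷ All.map inc to , cov (All.map there from) here

module _ {A : Set} (f : A → ℕ) where

  private
    tot-─ : ∀ {P : A → Set} {ys} (i : Any P ys) → suc (f (Any.lookup i)) + tot f (ys ─ i) ≡ tot f ys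
    tot-─ (here p) = refl
    tot-─ {ys = y ∷ ys} (there i) = begin
      suc (f l) + (suc (f y) + t) ≡⟨ +-assoc (suc (f l)) (suc (f y)) t ⟨
      suc (f l) + suc (f y) + t   ≡⟨ cong (_+ t) (+-comm (suc (f l)) (suc (f y))) ⟩
      suc (f y) + suc (f l) + t   ≡⟨ +-assoc (suc (f y)) (suc (f l)) t ⟩
      suc (f y) + (suc (f l) + t) ≡⟨ cong (suc (f y) +_) (tot-─ i) ⟩
      suc (f y) + tot f ys        ∎
      where
      open ≡-Reasoning
      l = Any.lookup i
      t = tot f (ys ─ i)

    avoid : ∀ {P Q : A → Set} {ys} (i : Any P ys) → ¬ Q (Any.lookup i) → Any Q ys → Any Q (ys ─ i)
    avoid (here p)  n (here q)  = ⊥-elim (n q)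
    avoid (here p)  n (there j) = j
    avoid (there i) n (here q)  = here q
    avoid (there i) n (there j) = there (avoid i n j)

  -- Elements of xs covered by the same element of ys would be E-equivalent, so the covering is injective.
  distinct⇒tot≤ : {E : A → A → Set} → (∀ {x y z} → E x z → E y z → E x y) →
    ∀ {xs ys} → AllPairs (λ x y → ¬ E x y) xs → Covered (λ x y → E x y × f x ≤ f y) xs ys → tot f xs ≤ tot f ys
  distinct⇒tot≤ join []       []       = z≤n
  distinct⇒tot≤ {E} join {xs = x ∷ xs} {ys} (d ∷ ds) (i ∷ is) = begin
    suc (f x) + tot f xs                          ≤⟨ +-mono-≤ (s≤s (proj₂ fx)) (distinct⇒tot≤ join ds is') ⟩
    suc (f (Any.lookup i)) + tot f (ys ─ i)       ≡⟨ tot-─ i ⟩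
    tot f ys                                      ∎
    where
    open ≤-Reasoning
    fx : E x (Any.lookup i) × f x ≤ f (Any.lookup i)
    fx = AnyP.lookup-result i
    is' : Covered (λ x y → E x y × f x ≤ f y) xs (ys ─ i)
    is' = All.zipWith (λ (n , j) → avoid i (λ (e , _) → n (join (proj₁ fx) e)) j) (d , is)

-- Lengths of clauses and conjunctions as sums

module Joined {A : Set} (f : A → ℕ) (g : List A → ℕ) (g-[] : g [] ≡ 1)
              (g-∷ : ∀ x xs → suc (g (x ∷ xs)) ≡ tot f (x ∷ xs)) (f-pos : ∀ x → 1 ≤ f x) where

  ≤suc-tot : ∀ xs → g xs ≤ suc (tot f xs)
  ≤suc-tot []       = ≤-reflexive g-[]
  ≤suc-tot (x ∷ xs) = ≤-trans (n≤1+n _) (≤-trans (≤-reflexive (g-∷ x xs)) (n≤1+n _))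

  tot≤suc : ∀ xs → tot f xs ≤ suc (g xs)
  tot≤suc []       = z≤n
  tot≤suc (x ∷ xs) = ≤-reflexive (sym (g-∷ x xs))

  positive : ∀ xs → 1 ≤ g xs
  positive []       = ≤-reflexive (sym g-[])
  positive (x ∷ xs) = ≤-trans (f-pos x) (≤-pred (≤-trans (m≤m+n _ _) (≤-reflexive (sym (g-∷ x xs)))))

  -- `g` is one below `tot f` on a nonempty list and one above it on the empty list. Between
  -- nonempty lists the shifts cancel, and the empty list has the least possible length.
  mono : ∀ xs ys → tot f xs ≤ tot f ys → g xs ≤ g ys
  mono []       ys       _ = ≤-trans (≤-reflexive g-[]) (positive ys)
  mono (x ∷ xs) (y ∷ ys) p = ≤-pred (subst (_≤ suc (g (y ∷ ys))) (sym (g-∷ x xs)) (≤-trans p (tot≤suc (y ∷ ys))))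

  member : ∀ {x xs} → x ∈ xs → f x ≤ g xs
  member i = ≤-pred (≤-trans (tot-∈ f i) (tot≤suc _))

lenA-pos : ∀ a → 1 ≤ lenA a
lenA-pos (pos p)  = s≤s z≤n
lenA-pos (neg p)  = s≤s z≤n
lenA-pos (box D)  = s≤s z≤n
lenA-pos (dia As) = s≤s z≤n

lenC-∷ : ∀ a C → suc (lenC (a ∷ C)) ≡ tot lenA (a ∷ C)
lenC-∷ a []      = sym (+-identityʳ _)
lenC-∷ a (b ∷ C) = cong (suc (lenA a) +_) (lenC-∷ b C)

module C = Joined lenA lenC refl lenC-∷ lenA-pos

lenS-∷ : ∀ C Cs → suc (lenS (C ∷ Cs)) ≡ tot lenC (C ∷ Cs)
lenS-∷ C []       = sym (+-identityʳ _)
lenS-∷ C (D ∷ Cs) = cong (suc (lenC C) +_) (lenS-∷ D Cs)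

module S = Joined lenC lenS refl lenS-∷ C.positive

-- Identity of clauses is an equivalence

infix 4 _⊑_

_⊑_ : Clause → Clause → Set
_⊑_ = Covered _≈A_

mutual
  ≈A-refl : ∀ a → a ≈A a
  ≈A-refl (pos p)  = pos≈
  ≈A-refl (neg p)  = neg≈
  ≈A-refl (box D)  = box≈ (≈C-refl D)
  ≈A-refl (dia As) = dia≈ (≈S-refl As)

  ≈C-refl : ∀ C → C ≈C C
  ≈C-refl C = mkC (⊑-refl C) (⊒-refl C)

  ≈S-refl : ∀ As → As ≈S As
  ≈S-refl As = mkS (⊑S-refl As) (⊒S-refl As)

  ⊑-refl : ∀ C → C ⊑ C
  ⊑-refl []      = []
  ⊑-refl (a ∷ C) = here (≈A-refl a) ∷ All.map there (⊑-refl C)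

  ⊒-refl : ∀ C → All (λ b → Any (_≈A b) C) C
  ⊒-refl []      = []
  ⊒-refl (a ∷ C) = here (≈A-refl a) ∷ All.map there (⊒-refl C)

  ⊑S-refl : ∀ As → Covered _≈C_ As As
  ⊑S-refl []       = []
  ⊑S-refl (C ∷ As) = here (≈C-refl C) ∷ All.map there (⊑S-refl As)

  ⊒S-refl : ∀ As → All (λ D → Any (_≈C D) As) As
  ⊒S-refl []       = []
  ⊒S-refl (C ∷ As) = here (≈C-refl C) ∷ All.map there (⊒S-refl As)

mutual
  ≈A-sym : ∀ {a b} → a ≈A b → b ≈A a
  ≈A-sym pos≈     = pos≈
  ≈A-sym neg≈     = neg≈
  ≈A-sym (box≈ e) = box≈ (≈C-sym e)
  ≈A-sym (dia≈ e) = dia≈ (≈S-sym e)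

  ≈C-sym : ∀ {C D} → C ≈C D → D ≈C C
  ≈C-sym (mkC p q) = mkC (⊒⇒⊑ q) (⊑⇒⊒ p)

  ≈S-sym : ∀ {As Bs} → As ≈S Bs → Bs ≈S As
  ≈S-sym (mkS p q) = mkS (⊒S⇒⊑S q) (⊑S⇒⊒S p)

  ⊑⇒⊒ : ∀ {C D} → C ⊑ D → All (λ b → Any (_≈A b) D) C
  ⊑⇒⊒ []       = []
  ⊑⇒⊒ (p ∷ ps) = symʳ p ∷ ⊑⇒⊒ ps

  ⊒⇒⊑ : ∀ {C D} → All (λ b → Any (_≈A b) D) C → C ⊑ D
  ⊒⇒⊑ []       = []
  ⊒⇒⊑ (p ∷ ps) = symˡ p ∷ ⊒⇒⊑ ps

  symʳ : ∀ {a D} → Any (a ≈A_) D → Any (_≈A a) D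
  symʳ (here e)  = here (≈A-sym e)
  symʳ (there i) = there (symʳ i)

  symˡ : ∀ {a D} → Any (_≈A a) D → Any (a ≈A_) D
  symˡ (here e)  = here (≈A-sym e)
  symˡ (there i) = there (symˡ i)

  ⊑S⇒⊒S : ∀ {As Bs} → Covered _≈C_ As Bs → All (λ D → Any (_≈C D) Bs) As
  ⊑S⇒⊒S []       = []
  ⊑S⇒⊒S (p ∷ ps) = symSʳ p ∷ ⊑S⇒⊒S ps

  ⊒S⇒⊑S : ∀ {As Bs} → All (λ D → Any (_≈C D) Bs) As → Covered _≈C_ As Bs
  ⊒S⇒⊑S []       = []
  ⊒S⇒⊑S (p ∷ ps) = symSˡ p ∷ ⊒S⇒⊑S ps

  symSʳ : ∀ {C Bs} → Any (C ≈C_) Bs → Any (_≈C C) Bs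
  symSʳ (here e)  = here (≈C-sym e)
  symSʳ (there i) = there (symSʳ i)

  symSˡ : ∀ {C Bs} → Any (_≈C C) Bs → Any (C ≈C_) Bs
  symSˡ (here e)  = here (≈C-sym e)
  symSˡ (there i) = there (symSˡ i)

mutual
  ≈A-trans : ∀ {a b c} → a ≈A b → b ≈A c → a ≈A c
  ≈A-trans pos≈     pos≈      = pos≈
  ≈A-trans neg≈     neg≈      = neg≈
  ≈A-trans (box≈ e) (box≈ e') = box≈ (≈C-trans e e')
  ≈A-trans (dia≈ e) (dia≈ e') = dia≈ (≈S-trans e e')

  ≈C-trans : ∀ {C D E} → C ≈C D → D ≈C E → C ≈C E
  ≈C-trans (mkC p q) (mkC p' q') = mkC (⊑-trans p p') (⊒-trans q' q)

  ≈S-trans : ∀ {As Bs Cs} → As ≈S Bs → Bs ≈S Cs → As ≈S Cs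
  ≈S-trans (mkS p q) (mkS p' q') = mkS (⊑S-trans p p') (⊒S-trans q' q)

  ⊑-trans : ∀ {C D E} → C ⊑ D → D ⊑ E → C ⊑ E
  ⊑-trans []       q = []
  ⊑-trans (i ∷ is) q = transʳ i q ∷ ⊑-trans is q

  ⊒-trans : ∀ {C D E} → All (λ b → Any (_≈A b) D) E → All (λ b → Any (_≈A b) C) D → All (λ b → Any (_≈A b) C) E
  ⊒-trans []       q = []
  ⊒-trans (i ∷ is) q = transˡ i q ∷ ⊒-trans is q

  transʳ : ∀ {a D E} → Any (a ≈A_) D → D ⊑ E → Any (a ≈A_) E
  transʳ (here e)  (j ∷ _) = transAnyʳ e j
  transʳ (there i) (_ ∷ q) = transʳ i q

  transAnyʳ : ∀ {a b E} → a ≈A b → Any (b ≈A_) E → Any (a ≈A_) E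
  transAnyʳ e (here e')  = here (≈A-trans e e')
  transAnyʳ e (there j)  = there (transAnyʳ e j)

  transˡ : ∀ {c C D} → Any (_≈A c) D → All (λ b → Any (_≈A b) C) D → Any (_≈A c) C
  transˡ (here e)  (j ∷ _) = transAnyˡ j e
  transˡ (there i) (_ ∷ q) = transˡ i q

  transAnyˡ : ∀ {b c C} → Any (_≈A b) C → b ≈A c → Any (_≈A c) C
  transAnyˡ (here e')  e = here (≈A-trans e' e)
  transAnyˡ (there j)  e = there (transAnyˡ j e)

  ⊑S-trans : ∀ {As Bs Cs} → Covered _≈C_ As Bs → Covered _≈C_ Bs Cs → Covered _≈C_ As Cs
  ⊑S-trans []       q = []
  ⊑S-trans (i ∷ is) q = transSʳ i q ∷ ⊑S-trans is q

  ⊒S-trans : ∀ {As Bs Cs} → All (λ D → Any (_≈C D) Bs) Cs → All (λ D → Any (_≈C D) As) Bs →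
             All (λ D → Any (_≈C D) As) Cs
  ⊒S-trans []       q = []
  ⊒S-trans (i ∷ is) q = transSˡ i q ∷ ⊒S-trans is q

  transSʳ : ∀ {C Bs Cs} → Any (C ≈C_) Bs → Covered _≈C_ Bs Cs → Any (C ≈C_) Cs
  transSʳ (here e)  (j ∷ _) = transSAnyʳ e j
  transSʳ (there i) (_ ∷ q) = transSʳ i q

  transSAnyʳ : ∀ {C D Cs} → C ≈C D → Any (D ≈C_) Cs → Any (C ≈C_) Cs
  transSAnyʳ e (here e') = here (≈C-trans e e')
  transSAnyʳ e (there j) = there (transSAnyʳ e j)

  transSˡ : ∀ {E As Bs} → Any (_≈C E) Bs → All (λ D → Any (_≈C D) As) Bs → Any (_≈C E) As
  transSˡ (here e)  (j ∷ _) = transSAnyˡ j e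
  transSˡ (there i) (_ ∷ q) = transSˡ i q

  transSAnyˡ : ∀ {D E As} → Any (_≈C D) As → D ≈C E → Any (_≈C E) As
  transSAnyˡ (here e') e = here (≈C-trans e' e)
  transSAnyˡ (there j) e = there (transSAnyˡ j e)

≈C⇒⊑ : ∀ {C D} → C ≈C D → C ⊑ D
≈C⇒⊑ (mkC p _) = p

⊑⊒⇒≈C : ∀ {C D} → C ⊑ D → D ⊑ C → C ≈C D
⊑⊒⇒≈C p q = mkC p (⊑⇒⊒ q)

-- Through this a conclusion of unknown length is replaced, below a modal operator, by an identical
-- clause cut out of a short one.
covered⇒≈C : ∀ {C X} → C ⊑ X → Σ Clause λ C₀ → C₀ ⊆ X × C ≈C C₀
covered⇒≈C p = let C₀ , s , to , from = covered⇒sublist _≈A_ p in C₀ , s , mkC to from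

-- Normal forms

NormalA : Atom → Set
NormalA a = ∀ b → ¬ StepA a b

Normal : Clause → Set
Normal C = ∀ D → ¬ StepC C D

NormalS : Conj → Set
NormalS As = ∀ Bs → ¬ StepS As Bs

normal-head : ∀ {a C} → Normal (a ∷ C) → NormalA a
normal-head n b s = n _ (here s)

normal-tail : ∀ {a C} → Normal (a ∷ C) → Normal C
normal-tail n D s = n _ (there s)

normalS-head : ∀ {C As} → NormalS (C ∷ As) → Normal C
normalS-head n D s = n _ (here s)

normalS-tail : ∀ {C As} → NormalS (C ∷ As) → NormalS As
normalS-tail n Bs s = n _ (there s)

normal⇒distinct : ∀ {C} → Normal C → AllPairs (λ a b → ¬ a ≈A b) C
normal⇒distinct {[]}    n = []
normal⇒distinct {a ∷ C} n = AllP.¬Any⇒All¬ C (λ i → n _ (drop-dup i)) ∷ normal⇒distinct (normal-tail n)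

normalS⇒distinct : ∀ {As} → NormalS As → AllPairs (λ C D → ¬ C ≈C D) As
normalS⇒distinct {[]}     n = []
normalS⇒distinct {C ∷ As} n = AllP.¬Any⇒All¬ As (λ i → n _ (drop-dup i)) ∷ normalS⇒distinct (normalS-tail n)

mutual
  normalA-≤ : ∀ {a b} → NormalA a → a ≈A b → lenA a ≤ lenA b
  normalA-≤ n pos≈     = ≤-refl
  normalA-≤ n neg≈     = ≤-refl
  normalA-≤ n (box≈ (mkC p _)) = s≤s (normal-≤ (λ _ s → n _ (in-box s)) p)
  normalA-≤ n (dia≈ (mkS p _)) = s≤s (normalS-≤ (λ _ s → n _ (in-dia s)) p)

  -- Distinct disjuncts of `C` have distinct partners in `D`, as a shared partner would make them
  -- identical. Comparing a disjunct with its partner is the same problem one level down, so freedom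
  -- from repetitions matters at every depth of `C`; `D` may repeat itself freely.
  normal-≤ : ∀ {C D} → Normal C → C ⊑ D → lenC C ≤ lenC D
  normal-≤ {C} {D} n p =
    C.mono C D (distinct⇒tot≤ lenA (λ e e' → ≈A-trans e (≈A-sym e')) (normal⇒distinct n) (cover-≤ n p))

  normalS-≤ : ∀ {As Bs} → NormalS As → Covered _≈C_ As Bs → lenS As ≤ lenS Bs
  normalS-≤ {As} {Bs} n p =
    S.mono As Bs (distinct⇒tot≤ lenC (λ e e' → ≈C-trans e (≈C-sym e')) (normalS⇒distinct n) (coverS-≤ n p))

  cover-≤ : ∀ {C D} → Normal C → C ⊑ D → Covered (λ a b → a ≈A b × lenA a ≤ lenA b) C D
  cover-≤ n []       = []
  cover-≤ n (i ∷ is) = cover-≤′ (normal-head n) i ∷ cover-≤ (normal-tail n) is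

  cover-≤′ : ∀ {a D} → NormalA a → Any (a ≈A_) D → Any (λ b → a ≈A b × lenA a ≤ lenA b) D
  cover-≤′ n (here e)  = here (e , normalA-≤ n e)
  cover-≤′ n (there i) = there (cover-≤′ n i)

  coverS-≤ : ∀ {As Bs} → NormalS As → Covered _≈C_ As Bs → Covered (λ C D → C ≈C D × lenC C ≤ lenC D) As Bs
  coverS-≤ n []       = []
  coverS-≤ n (i ∷ is) = coverS-≤′ (normalS-head n) i ∷ coverS-≤ (normalS-tail n) is

  coverS-≤′ : ∀ {C Bs} → Normal C → Any (C ≈C_) Bs → Any (λ D → C ≈C D × lenC C ≤ lenC D) Bs
  coverS-≤′ n (here e@(mkC p _)) = here (e , normal-≤ n p)
  coverS-≤′ n (there i)          = there (coverS-≤′ n i)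

-- prune removes every disjunct ◇(⊥, E) but keeps repetitions. Up to ≈C it is invariant under
-- simplification steps, and it fixes normal forms: so a normal form of C is ≈C to prune C.

bot? : (C : Clause) → Dec ([] ≡ C)
bot? []      = yes refl
bot? (a ∷ C) = no λ ()

pruneDia : Conj → Clause
pruneDia As with Any.any? bot? As
... | yes _ = []
... | no _  = dia As ∷ []

mutual
  pruneA : Atom → Clause
  pruneA (pos p)  = pos p ∷ []
  pruneA (neg p)  = neg p ∷ []
  pruneA (box D)  = box (prune D) ∷ []
  -- The conjuncts are pruned before the test for ⊥, because a conjunct such as ◇⊥ becomes empty
  -- only by pruning.
  pruneA (dia As) = pruneDia (pruneS As)

  prune : Clause → Clause
  prune []      = []
  prune (a ∷ C) = pruneA a ++ prune C

  pruneS : Conj → Conj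
  pruneS []       = []
  pruneS (C ∷ As) = prune C ∷ pruneS As

tot-pruneDia : ∀ As → tot lenA (pruneDia As) ≤ suc (suc (lenS As))
tot-pruneDia As with Any.any? bot? As
... | yes _ = z≤n
... | no _  = ≤-reflexive (+-identityʳ _)

mutual
  tot-pruneA : ∀ a → tot lenA (pruneA a) ≤ suc (lenA a)
  tot-pruneA (pos p)  = ≤-refl
  tot-pruneA (neg p)  = ≤-refl
  tot-pruneA (box D)  = ≤-trans (≤-reflexive (+-identityʳ _)) (s≤s (s≤s (C.mono (prune D) D (tot-prune D))))
  tot-pruneA (dia As) = ≤-trans (tot-pruneDia (pruneS As)) (s≤s (s≤s (S.mono (pruneS As) As (tot-pruneS As))))

  tot-prune : ∀ C → tot lenA (prune C) ≤ tot lenA C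
  tot-prune []      = z≤n
  tot-prune (a ∷ C) = ≤-trans (≤-reflexive (tot-++ lenA (pruneA a))) (+-mono-≤ (tot-pruneA a) (tot-prune C))

  tot-pruneS : ∀ As → tot lenC (pruneS As) ≤ tot lenC As
  tot-pruneS []       = z≤n
  tot-pruneS (C ∷ As) = +-mono-≤ (s≤s (C.mono (prune C) C (tot-prune C))) (tot-pruneS As)

bot-≈S : ∀ {As Bs} → As ≈S Bs → [] ∈ As → [] ∈ Bs
bot-≈S (mkS p _) i = Any.map (λ { {[]} _ → refl ; {_ ∷ _} (mkC _ (() ∷ _)) }) (All.lookup p i)

pruneDia-cong : ∀ {As Bs} → As ≈S Bs → pruneDia As ≈C pruneDia Bs
pruneDia-cong {As} {Bs} e with Any.any? bot? As | Any.any? bot? Bs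
... | yes _ | yes _ = ≈C-refl []
... | yes p | no n  = ⊥-elim (n (bot-≈S e p))
... | no n  | yes p = ⊥-elim (n (bot-≈S (≈S-sym e) p))
... | no _  | no _  = mkC (here (dia≈ e) ∷ []) (here (dia≈ e) ∷ [])

mutual
  pruneA-cong : ∀ {a b} → a ≈A b → pruneA a ≈C pruneA b
  pruneA-cong pos≈     = ≈C-refl _
  pruneA-cong neg≈     = ≈C-refl _
  pruneA-cong (box≈ e) = let e' = box≈ (prune-cong e) in mkC (here e' ∷ []) (here e' ∷ [])
  pruneA-cong (dia≈ e) = pruneDia-cong (pruneS-cong e)

  prune-cong : ∀ {C D} → C ≈C D → prune C ≈C prune D
  prune-cong (mkC p q) = mkC (prune-⊑ p) (⊑⇒⊒ (prune-⊒ q))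

  pruneS-cong : ∀ {As Bs} → As ≈S Bs → pruneS As ≈S pruneS Bs
  pruneS-cong (mkS p q) = mkS (pruneS-⊑ p) (pruneS-⊒ q)

  prune-⊑ : ∀ {C D} → C ⊑ D → prune C ⊑ prune D
  prune-⊑ []       = []
  prune-⊑ (i ∷ is) = AllP.++⁺ (prune-any i) (prune-⊑ is)

  prune-any : ∀ {a D} → Any (a ≈A_) D → pruneA a ⊑ prune D
  prune-any (here e)                  = All.map AnyP.++⁺ˡ (≈C⇒⊑ (pruneA-cong e))
  prune-any {D = b ∷ _} (there i) = All.map (AnyP.++⁺ʳ (pruneA b)) (prune-any i)

  prune-⊒ : ∀ {C D} → All (λ b → Any (_≈A b) C) D → prune D ⊑ prune C
  prune-⊒ []       = []
  prune-⊒ (i ∷ is) = AllP.++⁺ (prune-any′ i) (prune-⊒ is)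

  prune-any′ : ∀ {b C} → Any (_≈A b) C → pruneA b ⊑ prune C
  prune-any′ (here e)                  = All.map AnyP.++⁺ˡ (≈C⇒⊑ (≈C-sym (pruneA-cong e)))
  prune-any′ {C = a ∷ _} (there i) = All.map (AnyP.++⁺ʳ (pruneA a)) (prune-any′ i)

  pruneS-⊑ : ∀ {As Bs} → Covered _≈C_ As Bs → Covered _≈C_ (pruneS As) (pruneS Bs)
  pruneS-⊑ []       = []
  pruneS-⊑ (i ∷ is) = pruneS-any i ∷ pruneS-⊑ is

  pruneS-any : ∀ {C Bs} → Any (C ≈C_) Bs → Any (prune C ≈C_) (pruneS Bs)
  pruneS-any (here e)  = here (prune-cong e)
  pruneS-any (there i) = there (pruneS-any i)

  pruneS-⊒ : ∀ {As Bs} → All (λ D → Any (_≈C D) As) Bs → All (λ D → Any (_≈C D) (pruneS As)) (pruneS Bs)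
  pruneS-⊒ []       = []
  pruneS-⊒ (i ∷ is) = pruneS-any′ i ∷ pruneS-⊒ is

  pruneS-any′ : ∀ {D As} → Any (_≈C D) As → Any (_≈C prune D) (pruneS As)
  pruneS-any′ (here e)  = here (prune-cong e)
  pruneS-any′ (there i) = there (pruneS-any′ i)

bot∈pruneS : ∀ {As} → [] ∈ As → [] ∈ pruneS As
bot∈pruneS (here refl) = here refl
bot∈pruneS (there i)   = there (bot∈pruneS i)

pruneDia-bot : ∀ {As} → [] ∈ As → pruneDia As ≡ []
pruneDia-bot {As} i with Any.any? bot? As
... | yes _ = refl
... | no n  = ⊥-elim (n i)

pruneDia-¬bot : ∀ {As} → ¬ [] ∈ As → pruneDia As ≡ dia As ∷ []
pruneDia-¬bot {As} n with Any.any? bot? As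
... | yes i = ⊥-elim (n i)
... | no _  = refl

++-cong-≈C : ∀ {C C' D D'} → C ≈C C' → D ≈C D' → (C ++ D) ≈C (C' ++ D')
++-cong-≈C {C} {C'} (mkC p q) (mkC p' q') =
  mkC (AllP.++⁺ (All.map AnyP.++⁺ˡ p) (All.map (AnyP.++⁺ʳ C') p'))
      (AllP.++⁺ (All.map AnyP.++⁺ˡ q) (All.map (AnyP.++⁺ʳ C) q'))

∷-cong-≈S : ∀ {C C' As As'} → C ≈C C' → As ≈S As' → (C ∷ As) ≈S (C' ∷ As')
∷-cong-≈S e (mkS p q) = mkS (here e ∷ All.map there p) (here e ∷ All.map there q)

mutual
  pruneA-step : ∀ {a b} → StepA a b → pruneA a ≈C pruneA b
  pruneA-step (in-box s) = let e = box≈ (prune-step s) in mkC (here e ∷ []) (here e ∷ [])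
  pruneA-step (in-dia s) = pruneDia-cong (pruneS-step s)

  prune-step : ∀ {C D} → StepC C D → prune C ≈C prune D
  prune-step {D = D} (drop-dia⊥ i) rewrite pruneDia-bot (bot∈pruneS i) = ≈C-refl (prune D)
  prune-step {a ∷ _} {D} (drop-dup i) =
    ⊑⊒⇒≈C (AllP.++⁺ (prune-any i) (⊑-refl (prune D))) (All.map (AnyP.++⁺ʳ (pruneA a)) (⊑-refl (prune D)))
  prune-step (here {D = D} s)      = ++-cong-≈C (pruneA-step s) (≈C-refl (prune D))
  prune-step (there {a = a} s)     = ++-cong-≈C (≈C-refl (pruneA a)) (prune-step s)

  pruneS-step : ∀ {As Bs} → StepS As Bs → pruneS As ≈S pruneS Bs
  pruneS-step {Bs = Bs} (drop-dup i) =
    mkS (pruneS-any i ∷ ⊑S-refl (pruneS Bs)) (All.map there (⊒S-refl (pruneS Bs)))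
  pruneS-step (here {E = E} s)  = ∷-cong-≈S (prune-step s) (≈S-refl (pruneS E))
  pruneS-step (there {c = C} s) = ∷-cong-≈S (≈C-refl (prune C)) (pruneS-step s)

prune-steps : ∀ {C D} → Steps C D → prune C ≈C prune D
prune-steps refl       = ≈C-refl _
prune-steps (step s t) = ≈C-trans (prune-step s) (prune-steps t)

mutual
  prune-normal : ∀ {C} → Normal C → prune C ≡ C
  prune-normal {[]}         n = refl
  prune-normal {pos p ∷ C}  n = cong (pos p ∷_) (prune-normal (normal-tail n))
  prune-normal {neg p ∷ C}  n = cong (neg p ∷_) (prune-normal (normal-tail n))
  prune-normal {box D ∷ C}  n =
    cong₂ (λ D C → box D ∷ C) (prune-normal (λ _ s → normal-head n _ (in-box s))) (prune-normal (normal-tail n))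
  prune-normal {dia As ∷ C} n
    rewrite pruneS-normal {As} (λ _ s → normal-head n _ (in-dia s))
          | pruneDia-¬bot {As} (λ i → n _ (drop-dia⊥ i)) = cong (dia As ∷_) (prune-normal (normal-tail n))

  pruneS-normal : ∀ {As} → NormalS As → pruneS As ≡ As
  pruneS-normal {[]}     n = refl
  pruneS-normal {C ∷ As} n = cong₂ _∷_ (prune-normal (normalS-head n)) (pruneS-normal (normalS-tail n))

-- Simplification below a modal operator can produce a disjunct identical to none of `C`, so `N ⊑ X`
-- may fail. The comparison goes through `prune`: `N` equals `prune N`, which is identical to
-- `prune C`, which is covered by `prune X`; and pruning does not lengthen `X`.
nf-≤ : ∀ {C N X} → NF C N → C ⊑ X → lenC N ≤ lenC X
nf-≤ {C} {N} {X} (steps , n) p =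
  ≤-trans (normal-≤ n N⊑prune) (C.mono (prune X) X (tot-prune X))
  where
  N⊑prune : N ⊑ prune X
  N⊑prune = ⊑-trans (subst (_⊑ prune C) (prune-normal n) (≈C⇒⊑ (≈C-sym (prune-steps steps)))) (prune-⊑ p)

-- Variables and modal depth

data OkA (V : List ℕ) : ℕ → Atom → Set where
  ok-pos : ∀ {d p} → p ∈ V → OkA V d (pos p)
  ok-neg : ∀ {d p} → p ∈ V → OkA V d (neg p)
  ok-box : ∀ {d D} → All (OkA V d) D → OkA V (suc d) (box D)
  ok-dia : ∀ {d As} → All (All (OkA V d)) As → OkA V (suc d) (dia As)

Ok : List ℕ → ℕ → Clause → Set
Ok V d = All (OkA V d)

module _ {V : List ℕ} where

  mutual
    okA-≈ : ∀ {d a b} → a ≈A b → OkA V d b → OkA V d a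
    okA-≈ pos≈             (ok-pos i)  = ok-pos i
    okA-≈ neg≈             (ok-neg i)  = ok-neg i
    okA-≈ (box≈ (mkC p _)) (ok-box o)  = ok-box (ok-⊑ p o)
    okA-≈ (dia≈ (mkS p _)) (ok-dia os) = ok-dia (okS-⊑ p os)

    ok-⊑ : ∀ {d C D} → C ⊑ D → Ok V d D → Ok V d C
    ok-⊑ []       o = []
    ok-⊑ (i ∷ is) o = ok-any i o ∷ ok-⊑ is o

    ok-any : ∀ {d a D} → Any (a ≈A_) D → Ok V d D → OkA V d a
    ok-any (here e)  (o ∷ _) = okA-≈ e o
    ok-any (there i) (_ ∷ o) = ok-any i o

    okS-⊑ : ∀ {d As Bs} → Covered _≈C_ As Bs → All (Ok V d) Bs → All (Ok V d) As
    okS-⊑ []       o = []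
    okS-⊑ (i ∷ is) o = okS-any i o ∷ okS-⊑ is o

    okS-any : ∀ {d C Bs} → Any (C ≈C_) Bs → All (Ok V d) Bs → Ok V d C
    okS-any (here (mkC p _)) (o ∷ _) = ok-⊑ p o
    okS-any (there i)        (_ ∷ o) = okS-any i o

  ok-sig : ∀ {d A B C} → Sig A B C → Ok V d A → Ok V d B → Ok V d C
  ok-sig s-lit _ _ = []
  ok-sig s-bot _ _ = []
  ok-sig (s-sym s) oA oB = ok-sig s oB oA
  ok-sig (s-or {A} {B} s) oA oB = AllP.++⁺ (ok-sig s (AllP.++⁻ˡ A oA) (AllP.++⁻ˡ B oB)) (AllP.++⁺ (AllP.++⁻ʳ A oA) (AllP.++⁻ʳ B oB))
  ok-sig (s-boxdia s) (ok-box oA ∷ []) (ok-dia (oB ∷ oE) ∷ []) = ok-dia (oB ∷ ok-sig s oA oB ∷ oE) ∷ []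
  ok-sig (s-boxbox s) (ok-box oA ∷ []) (ok-box oB ∷ []) = ok-box (ok-sig s oA oB) ∷ []
  ok-sig (s-cong e e' s) oA oB = ok-sig s (ok-⊑ (≈C⇒⊑ e) oA) (ok-⊑ (≈C⇒⊑ e') oB)

  ok-gam : ∀ {d A B} → Gam A B → Ok V d A → Ok V d B
  ok-gam (g-dia2 s) (ok-dia (oA ∷ oB ∷ oF) ∷ []) = ok-dia (oA ∷ oB ∷ ok-sig s oA oB ∷ oF) ∷ []
  ok-gam (g-dia1 g) (ok-dia (oA ∷ oF) ∷ []) = ok-dia (ok-gam g oA ∷ oA ∷ oF) ∷ []
  ok-gam (g-or {A} g) o = AllP.++⁺ (ok-gam g (AllP.++⁻ˡ A o)) (AllP.++⁻ʳ A o)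
  ok-gam (g-box g) (ok-box o ∷ []) = ok-box (ok-gam g o) ∷ []
  ok-gam (g-cong e g) o = ok-gam g (ok-⊑ (≈C⇒⊑ e) o)

  mutual
    okA-step : ∀ {d a b} → StepA a b → OkA V d a → OkA V d b
    okA-step (in-box s) (ok-box o) = ok-box (ok-step s o)
    okA-step (in-dia s) (ok-dia o) = ok-dia (okS-step s o)

    ok-step : ∀ {d C D} → StepC C D → Ok V d C → Ok V d D
    ok-step (drop-dia⊥ _) (_ ∷ o)  = o
    ok-step (drop-dup _)  (_ ∷ o)  = o
    ok-step (here s)      (o ∷ os) = okA-step s o ∷ os
    ok-step (there s)     (o ∷ os) = o ∷ ok-step s os

    okS-step : ∀ {d As Bs} → StepS As Bs → All (Ok V d) As → All (Ok V d) Bs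
    okS-step (drop-dup _) (_ ∷ o)  = o
    okS-step (here s)     (o ∷ os) = ok-step s o ∷ os
    okS-step (there s)    (o ∷ os) = o ∷ okS-step s os

  ok-steps : ∀ {d C D} → Steps C D → Ok V d C → Ok V d D
  ok-steps refl       o = o
  ok-steps (step s t) o = ok-steps t (ok-step s o)

-- Variables and depth of the input

mutual
  varsA : Atom → List ℕ
  varsA (pos p)  = p ∷ []
  varsA (neg p)  = p ∷ []
  varsA (box D)  = varsC D
  varsA (dia As) = varsS As

  varsC : Clause → List ℕ
  varsC []      = []
  varsC (a ∷ C) = varsA a ++ varsC C

  varsS : Conj → List ℕ
  varsS []       = []
  varsS (C ∷ As) = varsC C ++ varsS As

length-++-≤ : ∀ (xs : List ℕ) {ys m n} → length xs ≤ m → length ys ≤ n → length (xs ++ ys) ≤ m + n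
length-++-≤ xs p q = ≤-trans (≤-reflexive (length-++ xs)) (+-mono-≤ p q)

mutual
  varsA-≤ : ∀ a → length (varsA a) ≤ lenA a
  varsA-≤ (pos p)  = ≤-refl
  varsA-≤ (neg p)  = s≤s z≤n
  varsA-≤ (box D)  = ≤-trans (varsC-≤ D) (n≤1+n _)
  varsA-≤ (dia As) = ≤-trans (varsS-≤ As) (n≤1+n _)

  varsC-≤ : ∀ C → length (varsC C) ≤ lenC C
  varsC-≤ []          = z≤n
  varsC-≤ (a ∷ [])    = ≤-trans (length-++-≤ (varsA a) (varsA-≤ a) z≤n) (≤-reflexive (+-identityʳ _))
  varsC-≤ (a ∷ b ∷ C) = length-++-≤ (varsA a) (varsA-≤ a) (≤-trans (varsC-≤ (b ∷ C)) (n≤1+n _))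

  varsS-≤ : ∀ As → length (varsS As) ≤ lenS As
  varsS-≤ []           = z≤n
  varsS-≤ (C ∷ [])     = ≤-trans (length-++-≤ (varsC C) (varsC-≤ C) z≤n) (≤-reflexive (+-identityʳ _))
  varsS-≤ (C ∷ D ∷ As) = length-++-≤ (varsC C) (varsC-≤ C) (≤-trans (varsS-≤ (D ∷ As)) (n≤1+n _))

varsS-≤* : ∀ {b U} → All (λ C → lenC C ≤ b) U → length (varsS U) ≤ length U * b
varsS-≤* []       = z≤n
varsS-≤* (_∷_ {C} p ps) = length-++-≤ (varsC C) (≤-trans (varsC-≤ C) p) (varsS-≤* ps)

mutual
  -- Every modal operator counts as a symbol, so depth is at most length: removing one operator
  -- lowers both bounds by one.
  okA-len : ∀ {V} d a → lenA a ≤ d → (∀ {p} → p ∈ varsA a → p ∈ V) → OkA V d a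
  okA-len d       (pos p)  _       i = ok-pos (i (here refl))
  okA-len d       (neg p)  _       i = ok-neg (i (here refl))
  okA-len (suc d) (box D)  (s≤s l) i = ok-box (ok-len d D l i)
  okA-len (suc d) (dia As) (s≤s l) i = ok-dia (okS-len d As l i)

  ok-len : ∀ {V} d C → lenC C ≤ d → (∀ {p} → p ∈ varsC C → p ∈ V) → Ok V d C
  ok-len d []      _ i = []
  ok-len d (a ∷ C) l i =
    okA-len d a (≤-trans (C.member {xs = a ∷ C} (here refl)) l) (i ∘ ∈-++⁺ˡ) ∷
    ok-len d C (≤-trans (C.mono C (a ∷ C) (m≤n+m _ (suc (lenA a)))) l) (i ∘ ∈-++⁺ʳ (varsA a))

  okS-len : ∀ {V} d As → lenS As ≤ d → (∀ {p} → p ∈ varsS As → p ∈ V) → All (Ok V d) As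
  okS-len d []       _ i = []
  okS-len d (C ∷ As) l i =
    ok-len d C (≤-trans (S.member {xs = C ∷ As} (here refl)) l) (i ∘ ∈-++⁺ˡ) ∷
    okS-len d As (≤-trans (S.mono As (C ∷ As) (m≤n+m _ (suc (lenC C)))) l) (i ∘ ∈-++⁺ʳ (varsC C))

ok-input : ∀ {V} d U → All (λ C → lenC C ≤ d) U → (∀ {p} → p ∈ varsS U → p ∈ V) → All (Ok V d) U
ok-input d []      []       i = []
ok-input d (C ∷ U) (l ∷ ls) i = ok-len d C l (i ∘ ∈-++⁺ˡ) ∷ ok-input d U ls (i ∘ ∈-++⁺ʳ (varsC C))

-- Growth of resolvents

-- At depth zero the disjuncts of both premises suffice as a cover, and 2 + `s` ≤ 2 * `s` since
-- their joint length `s` is at least 2. Each modal level adds one new atom with a cover from the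
-- level below inside; `tot-stepΣ` computes the summand 5.
growthΣ : ℕ → ℕ
growthΣ zero    = 2
growthΣ (suc d) = 5 + growthΣ d

-- Every derivation for Γ needs a modal operator in its premise, so 0 is enough at depth zero. In
-- the step, `g-dia2` resolves two conjuncts of one premise, each at most as long as that premise,
-- which gives `growthΣ d` twice; `g-dia1` and `g-box` give `growthΓ d`. The sum serves all three
-- rules.
growthΓ : ℕ → ℕ
growthΓ zero    = 0
growthΓ (suc d) = 6 + (growthΣ d + growthΣ d + growthΓ d)

2≤growthΣ : ∀ d → 2 ≤ growthΣ d
2≤growthΣ zero    = ≤-refl
2≤growthΣ (suc d) = s≤s (s≤s z≤n)

⊑-++ˡ : ∀ A B → A ⊑ A ++ B
⊑-++ˡ A B = All.map AnyP.++⁺ˡ (⊑-refl A)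

⊑-++ʳ : ∀ A B → B ⊑ A ++ B
⊑-++ʳ A B = All.map (AnyP.++⁺ʳ A) (⊑-refl B)

tot-++-≤ : ∀ A B → tot lenA (A ++ B) ≤ 2 + (lenC A + lenC B)
tot-++-≤ A B = begin
  tot lenA (A ++ B)           ≡⟨ tot-++ lenA A ⟩
  tot lenA A + tot lenA B     ≤⟨ +-mono-≤ (C.tot≤suc A) (C.tot≤suc B) ⟩
  suc (lenC A) + suc (lenC B) ≡⟨ cong suc (+-suc (lenC A) (lenC B)) ⟩
  2 + (lenC A + lenC B)       ∎
  where open ≤-Reasoning

tot-base : ∀ d A B → tot lenA (A ++ B) ≤ growthΣ d * (lenC A + lenC B)
tot-base d A B = begin
  tot lenA (A ++ B)                 ≤⟨ tot-++-≤ A B ⟩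
  2 + s                             ≤⟨ +-monoˡ-≤ s (+-mono-≤ (C.positive A) (C.positive B)) ⟩
  s + s                             ≡⟨ cong (s +_) (sym (+-identityʳ s)) ⟩
  2 * s                             ≤⟨ *-monoˡ-≤ s (2≤growthΣ d) ⟩
  growthΣ d * s                     ∎
  where
  open ≤-Reasoning
  s = lenC A + lenC B

-- `K` is the new atom: `g * s` bounds its resolved part, and the further `s` pays for the other
-- conjuncts under ◇. The constants add up to 5, which is at most `3 * s` because both clauses have
-- positive length.
tot-stepΣ : ∀ g K A B → let s = lenC A + lenC B in lenA K ≤ 2 + g * s + s → tot lenA (K ∷ A ++ B) ≤ (5 + g) * s
tot-stepΣ g K A B p = begin
  suc (lenA K) + tot lenA (A ++ B)     ≤⟨ +-mono-≤ (s≤s p) (tot-++-≤ A B) ⟩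
  suc (2 + g * s + s) + (2 + s)        ≡⟨ solve 2 (λ g s → con 1 :+ (con 2 :+ g :* s :+ s) :+ (con 2 :+ s) := con 5 :+ (s :+ s :+ g :* s)) refl g s ⟩
  5 + (s + s + g * s)                  ≤⟨ +-monoˡ-≤ (s + s + g * s) (≤-trans (n≤1+n 5) (*-monoʳ-≤ 3 (+-mono-≤ (C.positive A) (C.positive B)))) ⟩
  3 * s + (s + s + g * s)              ≡⟨ solve 2 (λ g s → con 3 :* s :+ (s :+ s :+ g :* s) := (con 5 :+ g) :* s) refl g s ⟩
  (5 + g) * s                          ∎
  where
  open ≤-Reasoning
  open +-*-Solver
  s = lenC A + lenC B

tot-stepΓ : ∀ g K A → lenA K ≤ 2 + g * lenC A + lenC A → tot lenA (K ∷ A) ≤ (6 + g) * lenC A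
tot-stepΓ g K A p = begin
  suc (lenA K) + tot lenA A            ≤⟨ +-mono-≤ (s≤s p) (C.tot≤suc A) ⟩
  suc (2 + g * s + s) + suc s          ≡⟨ solve 2 (λ g s → con 1 :+ (con 2 :+ g :* s :+ s) :+ (con 1 :+ s) := con 4 :+ (s :+ s :+ g :* s)) refl g s ⟩
  4 + (s + s + g * s)                  ≤⟨ +-monoˡ-≤ (s + s + g * s) (*-monoʳ-≤ 4 (C.positive A)) ⟩
  4 * s + (s + s + g * s)              ≡⟨ solve 2 (λ g s → con 4 :* s :+ (s :+ s :+ g :* s) := (con 6 :+ g) :* s) refl g s ⟩
  (6 + g) * s                          ∎
  where
  open ≤-Reasoning
  open +-*-Solver
  s = lenC A

⊆⇒lenC≤ : ∀ {C X b} → C ⊆ X → tot lenA X ≤ b → lenC C ≤ suc b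
⊆⇒lenC≤ {C} s l = ≤-trans (C.≤suc-tot C) (s≤s (≤-trans (tot-⊆ lenA s) l))

lenA-dia∷ : ∀ C Es {b n} → lenC C ≤ suc b → suc (lenS Es) ≤ n → lenA (dia (C ∷ Es)) ≤ 2 + b + n
lenA-dia∷ C Es {b} p q = begin
  suc (lenS (C ∷ Es))           ≡⟨ lenS-∷ C Es ⟩
  suc (lenC C) + tot lenC Es    ≤⟨ +-mono-≤ (s≤s p) (≤-trans (S.tot≤suc Es) q) ⟩
  2 + b + _                     ∎
  where open ≤-Reasoning

-- Iterated s-or only adds disjuncts of the premises, so at each modal level the conclusion
-- consists of disjuncts of the premises and at most one new atom.
sig-cover : ∀ {V d A B C A₀ B₀} → Sig A B C → Ok V d A₀ → Ok V d B₀ → A ⊑ A₀ → B ⊑ B₀ →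
  Σ Clause λ X → A₀ ⊑ X × B₀ ⊑ X × C ⊑ X × tot lenA X ≤ growthΣ d * (lenC A₀ + lenC B₀)
sig-cover {d = d} {A₀ = A₀} {B₀} s-lit _ _ _ _ = A₀ ++ B₀ , ⊑-++ˡ A₀ B₀ , ⊑-++ʳ A₀ B₀ , [] , tot-base d A₀ B₀
sig-cover {d = d} {A₀ = A₀} {B₀} s-bot _ _ _ _ = A₀ ++ B₀ , ⊑-++ˡ A₀ B₀ , ⊑-++ʳ A₀ B₀ , [] , tot-base d A₀ B₀
sig-cover {d = d} {A₀ = A₀} {B₀} (s-sym s) oA oB p q =
  let X , b , a , c , l = sig-cover s oB oA q p
  in X , a , b , c , subst (λ n → tot lenA X ≤ growthΣ d * n) (+-comm (lenC B₀) (lenC A₀)) l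
sig-cover (s-or {A} {B} s) oA oB p q =
  let X , a , b , c , l = sig-cover s oA oB (AllP.++⁻ˡ A p) (AllP.++⁻ˡ B q)
  -- The side disjuncts are covered by `A₀` and `B₀`, hence by `X`, which is reused unchanged. This
  -- is why `X` has to cover both premises and not only the conclusion.
  in X , a , b , AllP.++⁺ c (AllP.++⁺ (⊑-trans (AllP.++⁻ʳ A p) a) (⊑-trans (AllP.++⁻ʳ B q) b)) , l
sig-cover (s-cong e e' s) oA oB p q = sig-cover s oA oB (⊑-trans (≈C⇒⊑ e) p) (⊑-trans (≈C⇒⊑ e') q)
sig-cover {A₀ = A₀} {B₀} (s-boxbox s) oA oB (p ∷ []) (q ∷ [])
  with find p | find q
... | box A′ , i , box≈ (mkC a _) | box B′ , j , box≈ (mkC b _)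
  with All.lookup oA i | All.lookup oB j
... | ok-box {d} oA′ | ok-box oB′ =
  let X′ , _ , _ , c , l = sig-cover s oA′ oB′ a b
      C₀ , sub , e = covered⇒≈C c
      K = box C₀
      smaller = +-mono-≤ (≤-trans (n≤1+n _) (C.member i)) (≤-trans (n≤1+n _) (C.member j))
      l′ = s≤s (⊆⇒lenC≤ sub (≤-trans l (*-monoʳ-≤ (growthΣ d) smaller)))
  in K ∷ A₀ ++ B₀ , All.map there (⊑-++ˡ A₀ B₀) , All.map there (⊑-++ʳ A₀ B₀) , here (box≈ e) ∷ [] ,
     tot-stepΣ (growthΣ d) K A₀ B₀ (≤-trans l′ (m≤m+n _ _))
sig-cover {A₀ = A₀} {B₀} (s-boxdia s) oA oB (p ∷ []) (q ∷ [])
  with find p | find q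
... | box A′ , i , box≈ (mkC a _) | dia Es , j , dia≈ (mkS (b ∷ es) es′)
  with All.lookup oA i | All.lookup oB j | find b
... | ok-box {d} oA′ | ok-dia oEs | B′ , m , mkC b′ _ =
  let X′ , _ , _ , c , l = sig-cover s oA′ (All.lookup oEs m) a b′
      C₀ , sub , e = covered⇒≈C c
      -- `Es` is the copy of (B, E) that occurs in `B₀`; only the resolved conjunct has to be added
      -- to it.
      K = dia (C₀ ∷ Es)
      smaller = +-mono-≤ (≤-trans (n≤1+n _) (C.member i)) (≤-trans (S.member m) (≤-trans (n≤1+n _) (C.member j)))
      l′ = lenA-dia∷ C₀ Es (⊆⇒lenC≤ sub (≤-trans l (*-monoʳ-≤ (growthΣ d) smaller))) (≤-trans (C.member j) (m≤n+m _ (lenC A₀)))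
  in K ∷ A₀ ++ B₀ , All.map there (⊑-++ˡ A₀ B₀) , All.map there (⊑-++ʳ A₀ B₀) ,
     here (dia≈ (mkS (there b ∷ here e ∷ All.map there es)
                     (there (here e) ∷ All.map (λ { (here x) → here x ; (there x) → there (there x) }) es′))) ∷ [] ,
     tot-stepΣ (growthΣ d) K A₀ B₀ l′

gam-cover : ∀ {V d A B A₀} → Gam A B → Ok V d A₀ → A ⊑ A₀ →
  Σ Clause λ X → A₀ ⊑ X × B ⊑ X × tot lenA X ≤ growthΓ d * lenC A₀
gam-cover (g-or {A} g) o p =
  let X , a , b , l = gam-cover g o (AllP.++⁻ˡ A p)
  in X , a , AllP.++⁺ b (⊑-trans (AllP.++⁻ʳ A p) a) , l
gam-cover (g-cong e g) o p = gam-cover g o (⊑-trans (≈C⇒⊑ e) p)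
gam-cover {A₀ = A₀} (g-box g) o (p ∷ []) with find p
... | box A′ , i , box≈ (mkC a _) with All.lookup o i
... | ok-box {d} o′ =
  let X′ , _ , b , l = gam-cover g o′ a
      B₀ , sub , e = covered⇒≈C b
      K = box B₀
      factor = *-mono-≤ (m≤n+m (growthΓ d) (growthΣ d + growthΣ d)) (≤-trans (n≤1+n _) (C.member i))
      l′ = s≤s (⊆⇒lenC≤ sub (≤-trans l factor))
  in K ∷ A₀ , All.map there (⊑-refl A₀) , here (box≈ e) ∷ [] ,
     tot-stepΓ (growthΣ d + growthΣ d + growthΓ d) K A₀ (≤-trans l′ (m≤m+n _ _))
gam-cover {A₀ = A₀} (g-dia1 g) o (p ∷ []) with find p
... | dia Es , i , dia≈ (mkS (a ∷ es) es′) with All.lookup o i | find a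
... | ok-dia {d} oEs | A′ , m , mkC a′ _ =
  let X′ , _ , b , l = gam-cover g (All.lookup oEs m) a′
      B₀ , sub , e = covered⇒≈C b
      K = dia (B₀ ∷ Es)
      factor = *-mono-≤ (m≤n+m (growthΓ d) (growthΣ d + growthΣ d)) (≤-trans (S.member m) (≤-trans (n≤1+n _) (C.member i)))
  in K ∷ A₀ , All.map there (⊑-refl A₀) ,
     here (dia≈ (mkS (here e ∷ there a ∷ All.map there es) (here e ∷ All.map there es′))) ∷ [] ,
     tot-stepΓ (growthΣ d + growthΣ d + growthΓ d) K A₀ (lenA-dia∷ B₀ Es (⊆⇒lenC≤ sub (≤-trans l factor)) (C.member i))
gam-cover {A₀ = A₀} (g-dia2 s) o (p ∷ []) with find p
... | dia Es , i , dia≈ (mkS (a ∷ b ∷ es) es′) with All.lookup o i | find a | find b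
... | ok-dia {d} oEs | A′ , m , mkC a′ _ | B′ , m′ , mkC b′ _ =
  let X′ , _ , _ , c , l = sig-cover s (All.lookup oEs m) (All.lookup oEs m′) a′ b′
      C₀ , sub , e = covered⇒≈C c
      K = dia (C₀ ∷ Es)
      Es≤ = ≤-trans (n≤1+n _) (C.member i)
      factor = begin
        growthΣ d * (lenC A′ + lenC B′)                       ≤⟨ *-monoʳ-≤ (growthΣ d) (+-mono-≤ (≤-trans (S.member m) Es≤) (≤-trans (S.member m′) Es≤)) ⟩
        growthΣ d * (lenC A₀ + lenC A₀)                       ≡⟨ *-distribˡ-+ (growthΣ d) (lenC A₀) (lenC A₀) ⟩
        growthΣ d * lenC A₀ + growthΣ d * lenC A₀             ≡⟨ sym (*-distribʳ-+ (lenC A₀) (growthΣ d) (growthΣ d)) ⟩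
        (growthΣ d + growthΣ d) * lenC A₀                     ≤⟨ *-monoˡ-≤ (lenC A₀) (m≤m+n (growthΣ d + growthΣ d) (growthΓ d)) ⟩
        (growthΣ d + growthΣ d + growthΓ d) * lenC A₀         ∎
  in K ∷ A₀ , All.map there (⊑-refl A₀) ,
     here (dia≈ (mkS (there a ∷ there b ∷ here e ∷ All.map there es)
                     (there (there (here e)) ∷
                      All.map (λ { (here x) → here x ; (there (here x)) → there (here x) ; (there (there x)) → there (there (there x)) }) es′))) ∷ [] ,
     tot-stepΓ (growthΣ d + growthΣ d + growthΓ d) K A₀ (lenA-dia∷ C₀ Es (⊆⇒lenC≤ sub (≤-trans l factor)) (C.member i))
  where open ≤-Reasoning

-- Counting normal forms

powerset : {A : Set} → List A → List (List A)
powerset []       = [] ∷ []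
powerset (x ∷ xs) = map (x ∷_) (powerset xs) ++ powerset xs

module _ {A : Set} where

  ∈-powerset : ∀ {xs ys : List A} → xs ⊆ ys → xs ∈ powerset ys
  ∈-powerset []                       = here refl
  ∈-powerset {ys = _ ∷ ys} (y ∷ʳ s)   = ∈-++⁺ʳ (map (y ∷_) (powerset ys)) (∈-powerset s)
  ∈-powerset {x ∷ _} (refl ∷ s)       = ∈-++⁺ˡ (∈-map⁺ (x ∷_) (∈-powerset s))

  powerset-⊆ : ∀ (ys : List A) → All (_⊆ ys) (powerset ys)
  powerset-⊆ []       = [] ∷ []
  powerset-⊆ (y ∷ ys) = AllP.++⁺ (AllP.map⁺ (All.map (refl ∷_) (powerset-⊆ ys))) (All.map (y ∷ʳ_) (powerset-⊆ ys))

  length-powerset : ∀ (ys : List A) → length (powerset ys) ≡ 2 ^ length ys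
  length-powerset []       = refl
  length-powerset (y ∷ ys) = trans (length-++ (map (y ∷_) (powerset ys)))
    (cong₂ _+_ (trans (length-map (y ∷_) (powerset ys)) (length-powerset ys))
               (trans (length-powerset ys) (sym (+-identityʳ _))))

-- `2 ^ n` bounds the number of sublists. Of the two extra units one allows for the empty list, of
-- length 1, and one is the unit that `tot` adds per entry.
powerBound : ℕ → ℕ
powerBound n = 2 ^ n * suc (suc n)

tot-powerset : {A : Set} (f : A → ℕ) (g : List A → ℕ) → (∀ xs → g xs ≤ suc (tot f xs)) →
               ∀ {b} ys → tot f ys ≤ b → tot g (powerset ys) ≤ powerBound b
tot-powerset f g g≤ {b} ys l = begin
  tot g (powerset ys)                  ≤⟨ tot≤length* g (All.map (λ {xs} s → ≤-trans (g≤ xs) (s≤s (≤-trans (tot-⊆ f s) l))) (powerset-⊆ ys)) ⟩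
  length (powerset ys) * suc (suc b)   ≡⟨ cong (_* suc (suc b)) (length-powerset ys) ⟩
  2 ^ length ys * suc (suc b)          ≤⟨ *-monoˡ-≤ (suc (suc b)) (^-monoʳ-≤ 2 (≤-trans (length≤tot f ys) l)) ⟩
  powerBound b                         ∎
  where open ≤-Reasoning

-- Representatives of all atoms of bounded depth

literals : List ℕ → Clause
literals V = map pos V ++ map neg V

-- Up to identity the body of a □ is a set of atoms one level down and that of a ◇ a set of such
-- sets, hence one powerset and two. The representatives form a single clause, so that `normal-≤`
-- applies to it.
universe : List ℕ → ℕ → Clause
universe V zero    = literals V
universe V (suc d) = literals V ++ map box (powerset (universe V d)) ++ map dia (powerset (powerset (universe V d)))

literalBound : ℕ → ℕ
literalBound v = (v + v) * 3

-- Only the number of variables enters, so the bound is the same for all inputs of a given size. The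
-- doublings come from `tot-map`.
universeBound : ℕ → ℕ → ℕ
universeBound v zero    = literalBound v
universeBound v (suc d) = literalBound v + ((p + p) + (q + q))
  where
  p = powerBound (universeBound v d)
  q = powerBound p

tot-literals : ∀ V {v} → length V ≤ v → tot lenA (literals V) ≤ literalBound v
tot-literals V {v} l = begin
  tot lenA (literals V)    ≤⟨ tot≤length* lenA (AllP.++⁺ (AllP.map⁺ (All.universal (λ _ → s≤s z≤n) V)) (AllP.map⁺ (All.universal (λ _ → ≤-refl) V))) ⟩
  length (literals V) * 3  ≡⟨ cong (_* 3) (trans (length-++ (map pos V)) (cong₂ _+_ (length-map pos V) (length-map neg V))) ⟩
  (length V + length V) * 3 ≤⟨ *-monoˡ-≤ 3 (+-mono-≤ l l) ⟩
  literalBound v           ∎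
  where open ≤-Reasoning

tot-universe : ∀ {V v} → length V ≤ v → ∀ d → tot lenA (universe V d) ≤ universeBound v d
tot-universe {V} l zero = tot-literals V l
tot-universe {V} {v} l (suc d) = begin
  tot lenA (literals V ++ boxes ++ dias)                        ≡⟨ trans (tot-++ lenA (literals V)) (cong (tot lenA (literals V) +_) (tot-++ lenA boxes)) ⟩
  tot lenA (literals V) + (tot lenA boxes + tot lenA dias)      ≤⟨ +-mono-≤ (tot-literals V l) (+-mono-≤
                                                                     (≤-trans (tot-map lenC lenA box (λ _ → refl) (powerset u)) (+-mono-≤ p p))
                                                                     (≤-trans (tot-map lenS lenA dia (λ _ → refl) (powerset (powerset u))) (+-mono-≤ q q))) ⟩
  universeBound v (suc d)                                       ∎
  where
  open ≤-Reasoning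
  u = universe V d
  boxes = map box (powerset u)
  dias  = map dia (powerset (powerset u))
  p = tot-powerset lenA lenC C.≤suc-tot u (tot-universe l d)
  q = tot-powerset lenC lenS S.≤suc-tot (powerset u) p

literals⊆universe : ∀ {V a} d → a ∈ literals V → a ∈ universe V d
literals⊆universe zero    i = i
literals⊆universe (suc d) i = ∈-++⁺ˡ i

mutual
  okA⇒universe : ∀ {V d a} → OkA V d a → Any (a ≈A_) (universe V d)
  okA⇒universe {d = d} (ok-pos i) = lose (literals⊆universe d (∈-++⁺ˡ (∈-map⁺ pos i))) pos≈
  okA⇒universe {V} {d} (ok-neg i) = lose (literals⊆universe d (∈-++⁺ʳ (map pos V) (∈-map⁺ neg i))) neg≈
  okA⇒universe {V} (ok-box o) =
    let _ , s , e = covered⇒≈C (ok⇒⊑universe o)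
    in lose (∈-++⁺ʳ (literals V) (∈-++⁺ˡ (∈-map⁺ box (∈-powerset s)))) (box≈ e)
  okA⇒universe {V} {suc d} (ok-dia os) =
    let _ , s , to , from = covered⇒sublist _≈C_ (okS⇒powerset os)
    in lose (∈-++⁺ʳ (literals V) (∈-++⁺ʳ (map box (powerset (universe V d))) (∈-map⁺ dia (∈-powerset s))))
            (dia≈ (mkS to from))

  ok⇒⊑universe : ∀ {V d C} → Ok V d C → C ⊑ universe V d
  ok⇒⊑universe []       = []
  ok⇒⊑universe (o ∷ os) = okA⇒universe o ∷ ok⇒⊑universe os

  okS⇒powerset : ∀ {V d As} → All (Ok V d) As → Covered _≈C_ As (powerset (universe V d))
  okS⇒powerset []       = []
  okS⇒powerset (o ∷ os) =
    (let _ , s , e = covered⇒≈C (ok⇒⊑universe o) in lose (∈-powerset s) e) ∷ okS⇒powerset os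

normal-bounded : ∀ {V v d N} → length V ≤ v → Normal N → Ok V d N → lenC N ≤ suc (universeBound v d)
normal-bounded {V} {d = d} l n o =
  ≤-trans (normal-≤ n (ok⇒⊑universe o)) (≤-trans (C.≤suc-tot (universe V d)) (s≤s (tot-universe l d)))

-- Runs

-- The extra unit pays for the empty clause, which has length 1 but sum 0, and keeps the factor
-- nonzero, so that surviving clauses also meet the enlarged bound.
growth : ℕ → ℕ
growth d = suc (growthΣ d + growthΣ d + growthΓ d)

data Stage (V : List ℕ) (d b : ℕ) (N : Clause) : Set where
  old : Ok V d N → lenC N ≤ b → Stage V d b N
  new : Ok V d N → Normal N → lenC N ≤ growth d * b → Stage V d b N

Bounded : List ℕ → ℕ → ℕ → Clause → Set
Bounded V d b C = Ok V d C × lenC C ≤ b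

cover⇒≤growth : ∀ {d b C N X} → 1 ≤ b → NF C N → C ⊑ X →
                tot lenA X ≤ (growthΣ d + growthΣ d + growthΓ d) * b → lenC N ≤ growth d * b
cover⇒≤growth {X = X} 1≤b nf c l = ≤-trans (nf-≤ nf c) (≤-trans (C.≤suc-tot X) (+-mono-≤ 1≤b l))

stage : ∀ {V d b U N} → All (Bounded V d b) U → InL U N → Stage V d b N
stage bs (orig i) = let o , l = All.lookup bs i in old o l
stage {d = d} {b} bs (resΣ {A} {B} i j s nf@(steps , n)) =
  let oA , lA = All.lookup bs i
      oB , lB = All.lookup bs j
      X , _ , _ , c , l = sig-cover s oA oB (⊑-refl A) (⊑-refl B)
  in new (ok-steps steps (ok-sig s oA oB)) n (cover⇒≤growth {d} (≤-trans (C.positive A) lA) nf c (≤-trans l (bound lA lB)))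
  where
  open ≤-Reasoning
  bound : ∀ {m n} → m ≤ b → n ≤ b → growthΣ d * (m + n) ≤ (growthΣ d + growthΣ d + growthΓ d) * b
  bound {m} {n} p q = begin
    growthΣ d * (m + n)                         ≤⟨ *-monoʳ-≤ (growthΣ d) (+-mono-≤ p q) ⟩
    growthΣ d * (b + b)                         ≡⟨ *-distribˡ-+ (growthΣ d) b b ⟩
    growthΣ d * b + growthΣ d * b               ≡⟨ *-distribʳ-+ b (growthΣ d) (growthΣ d) ⟨
    (growthΣ d + growthΣ d) * b                 ≤⟨ *-monoˡ-≤ b (m≤m+n (growthΣ d + growthΣ d) (growthΓ d)) ⟩
    (growthΣ d + growthΣ d + growthΓ d) * b     ∎
stage {d = d} {b} bs (resΓ {A} i g nf@(steps , n)) =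
  let o , lA = All.lookup bs i
      X , _ , c , l = gam-cover g o (⊑-refl A)
  in new (ok-steps steps (ok-gam g o)) n
       (cover⇒≤growth {d} (≤-trans (C.positive A) lA) nf c
         (≤-trans l (*-mono-≤ (m≤n+m (growthΓ d) (growthΣ d + growthΣ d)) lA)))

run-geometric : ∀ {V d b U k O} → All (Bounded V d b) U → Run U k O → All (λ C → lenC C ≤ b * growth d ^ k) O
run-geometric {V} {d} {b} bs run = go run bs
  where
  grow : ∀ {b N} → Stage V d b N → Bounded V d (b * growth d) N
  grow {b} (old o l)   = o , ≤-trans l (m≤m*n b (growth d))
  grow {b} (new o _ l) = o , ≤-trans l (≤-reflexive (*-comm (growth d) b))

  go : ∀ {b U k O} → Run U k O → All (Bounded V d b) U → All (λ C → lenC C ≤ b * growth d ^ k) O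
  go r-empty bs = []
  go {b} (r-stop _ (inL , _) _) bs =
    All.map (λ i → ≤-trans (proj₂ (grow (stage bs i))) (*-monoʳ-≤ b (≤-reflexive (sym (*-identityʳ _))))) inL
  go {b} (r-next {k = k} _ (inL , _) _ r) bs =
    All.map (λ l → ≤-trans l (≤-reflexive (*-assoc b (growth d) (growth d ^ k))))
            (go r (All.map (λ i → grow (stage bs i)) inL))

-- A `b` that bounds the input and all admissible normal forms is invariant under a stage.
run-constant : ∀ {V v d b U k O} → length V ≤ v → suc (universeBound v d) ≤ b →
               All (Bounded V d b) U → Run U k O → All (λ C → lenC C ≤ b) O
run-constant {V} {v} {d} {b} l u bs run = go run bs
  where
  keep : ∀ {N} → Stage V d b N → Bounded V d b N
  keep (old o p)   = o , p
  keep (new o n _) = o , ≤-trans (normal-bounded l n o) u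

  go : ∀ {U k O} → Run U k O → All (Bounded V d b) U → All (λ C → lenC C ≤ b) O
  go r-empty                   bs = []
  go (r-stop _ (inL , _) _)    bs = All.map (λ i → proj₂ (keep (stage bs i))) inL
  go (r-next _ (inL , _) _ r)  bs = go r (All.map (λ i → keep (stage bs i)) inL)

theorem6 : ∀ (ℓ : ℕ) → ∃ λ (c : ℕ) →
    ∀ (U : List Clause) (k : ℕ) (O : List Clause) →
    NoDup U → All (λ D → lenC D ≤ ℓ) U → Run U k O →
    All (λ D → lenC D ≤ c * length U ^ k) O
theorem6 ℓ = c , bound
  where
  M = growth ℓ
  -- At most `M` clauses of length at most `ℓ` contain at most `M * ℓ` occurrences of variables.
  b = suc (universeBound (M * ℓ) ℓ)
  c = ℓ ⊔ b

  bounded : ∀ {U} (h : ℕ) → ℓ ≤ h → All (λ D → lenC D ≤ ℓ) U → All (Bounded (varsS U) ℓ h) U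
  bounded {U} h ℓ≤h ls = All.zipWith (λ (o , l) → o , ≤-trans l ℓ≤h) (ok-input ℓ U ls id , ls)

  bound : ∀ U k O → NoDup U → All (λ D → lenC D ≤ ℓ) U → Run U k O → All (λ D → lenC D ≤ c * length U ^ k) O
  bound [] _ _ _ _ r-empty           = []
  bound [] _ _ _ _ (r-stop ne _ _)   = ⊥-elim (ne refl)
  bound [] _ _ _ _ (r-next ne _ _ _) = ⊥-elim (ne refl)
  bound U@(_ ∷ _) k O _ ls r with ≤-total M (length U)
  ... | inj₁ M≤n = All.map (λ l → ≤-trans l (*-mono-≤ (m≤m⊔n ℓ b) (^-monoˡ-≤ k M≤n))) (run-geometric (bounded ℓ ≤-refl ls) r)
  ... | inj₂ n≤M =
    -- The input is nonempty, so `length U ^ k` is at least 1 and the constant bound survives the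
    -- multiplication.
    All.map (λ l → ≤-trans l (m≤m*n c (length U ^ k) {{m^n≢0 (length U) k}}))
      (run-constant (≤-trans (varsS-≤* ls) (*-monoˡ-≤ ℓ n≤M)) (m≤n⊔m ℓ b) (bounded c (m≤m⊔n ℓ b) ls) r)
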